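{- Let $s$ be a weak composition and let $T_1\preccurlyeq T_2$ be two $s$-decreasing trees. Then $[T_1,T_2]$ is a pure interval if and only if it is a $+1$-interval and for all $a<b<c$ (and all values $v,w$): (1) if $(c,a)_v\in\operatorname{Var}([T_1,T_2])$ and $(b,a)_w\in\operatorname{Var}([T_1,T_2])$, then $(c,b)_v\in \operatorname{Var}([T_1,T_2])$; (2) if $(c,a)_v\in\operatorname{EVar}([T_1,T_2])$ and $(c,b)_v\in\operatorname{EVar}([T_1,T_2])$ and $s(b)\neq 0$, then $(b,a)_0\in\operatorname{Var}([T_1,T_2])$.
   Context: A weak composition of length $n$ is a sequence $s=(s(1),\dots,s(n))$ of non-negative integers. An $s$-decreasing tree is a rooted planar tree with $n$ internal nodes labeled bijectively by $1,\dots,n$ (leaves are unlabeled) such that node $i$ has exactly $s(i)+1$ ordered children and labels decrease from root to leaves. For a node $y$ of such a tree $T$ with $s(y)=m$, let $T^y_0,\dots,T^y_m$ be the children of $y$ from left to right, where "child" means the whole subtree; a child is empty if it is just a leaf. $T^y_0$ is the left child, $T^y_m$ the right child (strict right child if $m>0$), and $T^y_i$ with $0<i<m$ are the middle children. A descendant of $y$ is a node lying in one of the $T^y_i$. Tree-inversions: for nodes $a<c$, $\#_T(c,a)$ is $0$ if $a$ is left of $c$ or belongs to $T^c_0$; it is $i$ if $a$ belongs to $T^c_i$ with $0<i<s(c)$; it is $s(c)$ if $a$ belongs to $T^c_{s(c)}$ or is right of $c$. $\operatorname{inv}(T)$ is the multi-set in which $(c,a)$ occurs $\#_T(c,a)$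 times; it determines $T$. The $s$-weak order: $R\preccurlyeq T$ iff $\#_R(c,a)\le \#_T(c,a)$ for all $a<c$. Intervals are $[T_1,T_2]=\{R: T_1\preccurlyeq R\preccurlyeq T_2\}$. Transitive closure: for a multi-set $I$ of pairs $(c,a)$, $a<c$, with multiplicities $\#_I(c,a)$, a transitivity path from $c$ to $a$ is a list $c=b_1>\dots>b_k=a$, $k\ge2$, with $\#_I(b_i,b_{i+1})>0$ for all $i$; $\#_{I^{\mathsf{tc}}}(c,a)$ is the maximal value of $\#_I(b_1,b_2)$ over all such paths (and $0$ if there is none). A pair $(a,c)$ with $a<c$ is a tree-ascent of $T$ if: (i) $a$ is a descendant of $c$; (ii) $a$ does not belong to the right child of $c$; (iii) whenever $c>b>a$ and $a$ is a descendant of $b$, $a$ belongs to the right child of $b$; (iv) if $s(a)>0$, the right child of $a$ is empty. For a (possibly empty) set $A$ of tree-ascents of $T$, $T+A$ is the $s$-decreasing tree whose multi-set of tree-inversions is obtained from $\operatorname{inv}(T)$ by increasing $\#_T(c,a)$ by one for every $(a,c)\in A$ and then taking the transitive closure. $[T_1,T_2]$ is a pure interval if $T_2=T_1+A$ for some set $A$ of tree-ascents of $T_1$. Variations: $(c,a)$ with $c>a$ varies in $[T_1,T_2]$ if $\#_{T_2}(c,a)>\#_{T_1}(c,a)$; then $(c,a)_v$ with $v=\#_{T_1}(c,a)$ is a variation of $[T_1,T_2]$ (of value $v$), and its amplitude is $\#_{T_2}(c,a)-\#_{T_1}(c,a)$. A variation $(c,a)_v$ is essential if there is no $b$ with $a<b<c$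 such that $a$ belongs to a middle child of $b$ in $T_1$ and $(c,b)$ varies. $\operatorname{Var}([T_1,T_2])$ and $\operatorname{EVar}([T_1,T_2])$ denote the sets of variations and of essential variations. $[T_1,T_2]$ is a $+1$-interval if all its variations have amplitude one, i.e. $\#_{T_1}(b,a)\le\#_{T_2}(b,a)\le\#_{T_1}(b,a)+1$ for all $a<b$. -}

module Defs where

open import Data.Bool using (Bool; true; if_then_else_)
open import Data.Fin using (Fin; toℕ; fromℕ; _<_)
open import Data.Fin.Properties using (_≟_; _<?_; any?)
open import Data.Nat as ℕ using (ℕ; suc; _+_; _∸_)
open import Data.Product using (_×_; _,_; ∃-syntax)
open import Data.Sum using (_⊎_; inj₁; inj₂)
open import Data.Unit using (⊤)
open import Data.Vec.Functional using (Vector)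
open import Relation.Binary.Construct.Closure.Transitive using (TransClosure; [_]; _∷_)
open import Relation.Binary.PropositionalEquality using (_≡_; refl)
open import Relation.Nullary using (¬_; Dec; yes; no)
open import Relation.Nullary.Decidable using (map′; _×-dec_; _⊎-dec_)

-- The labels 1, …, n are represented by Fin n with its usual order.

WeakComposition : ℕ → Set
WeakComposition n = Vector ℕ n

data Tree {n : ℕ} (s : WeakComposition n) : Set where
  leaf : Tree s
  node : (y : Fin n) → Vector (Tree s) (suc (s y)) → Tree s

module _ {n : ℕ} {s : WeakComposition n} where

  infix 4 _∈_ _∈?_

  -- The elements of a ∈ t are the internal nodes of t labelled a.
  data _∈_ (a : Fin n) : Tree s → Set where
    here  : ∀ {ts} → a ∈ node a ts
    there : ∀ {y ts} (i : Fin (suc (s y))) → a ∈ ts i → a ∈ node y ts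

  _∈?_ : (a : Fin n) (t : Tree s) → Dec (a ∈ t)
  a ∈? leaf      = no λ ()
  a ∈? node y ts =
    map′ (λ { (inj₁ refl) → here ; (inj₂ (i , p)) → there i p })
         (λ { here → inj₁ refl ; (there i p) → inj₂ (i , p) })
         ((a ≟ y) ⊎-dec any? (λ i → a ∈? ts i))

  -- In t, node a is left of node c (neither being an ancestor of the other).
  data LeftOf (a c : Fin n) : Tree s → Set where
    split  : ∀ {y ts} (i j : Fin (suc (s y))) → i < j → a ∈ ts i → c ∈ ts j →
             LeftOf a c (node y ts)
    inside : ∀ {y ts} (i : Fin (suc (s y))) → LeftOf a c (ts i) →
             LeftOf a c (node y ts)

  leftOf? : (a c : Fin n) (t : Tree s) → Dec (LeftOf a c t)
  leftOf? a c leaf        = no λ ()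
  leftOf? a c (node y ts) =
    map′ (λ { (inj₁ (i , j , i<j , p , q)) → split i j i<j p q
            ; (inj₂ (i , p)) → inside i p })
         (λ { (split i j i<j p q) → inj₁ (i , j , i<j , p , q)
            ; (inside i p) → inj₂ (i , p) })
         (any? (λ i → any? (λ j → (i <? j) ×-dec ((a ∈? ts i) ×-dec (c ∈? ts j))))
          ⊎-dec any? (λ i → leftOf? a c (ts i)))

  Decreasing : Tree s → Set
  Decreasing leaf        = ⊤
  Decreasing (node y ts) = ∀ i → (∀ a → a ∈ ts i → a < y) × Decreasing (ts i)

  subtrees : ∀ {y} {t : Tree s} → y ∈ t → Vector (Tree s) (suc (s y))
  subtrees (here {ts}) = ts
  subtrees (there _ p) = subtrees p

-- Each label is carried by exactly one internal node.
record DecreasingTree {n : ℕ} (s : WeakComposition n) : Set where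
  field
    tree       : Tree s
    decreasing : Decreasing tree
    nodeOf     : ∀ a → a ∈ tree
    unique     : ∀ {a} (p q : a ∈ tree) → p ≡ q

-- A multi-set of pairs (c , a) with a < c is given by its multiplicities;
-- values at other pairs are irrelevant throughout.
MultiSet : ℕ → Set
MultiSet n = Fin n → Fin n → ℕ

module _ {n : ℕ} {s : WeakComposition n} where

  open DecreasingTree

  child : (T : DecreasingTree s) (y : Fin n) → Vector (Tree s) (suc (s y))
  child T y = subtrees (nodeOf T y)

  rightChild : DecreasingTree s → Fin n → Tree s
  rightChild T y = child T y (fromℕ (s y))

  Descendant : DecreasingTree s → Fin n → Fin n → Set
  Descendant T a y = ∃[ i ] a ∈ child T y i

  InMiddleChild : DecreasingTree s → Fin n → Fin n → Set
  InMiddleChild T a y =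
    ∃[ i ] 0 ℕ.< toℕ i × toℕ i ℕ.< s y × a ∈ child T y i

  -- When a < c, node a is a descendant of c, right of c or left of c;
  -- the left and right children have indices 0 and s c.
  inv : DecreasingTree s → MultiSet n
  inv T c a with any? (λ i → a ∈? child T c i) | leftOf? c a (tree T)
  ... | yes (i , _) | _     = toℕ i
  ... | no _        | yes _ = s c
  ... | no _        | no _  = 0

  infix 4 _≼_

  _≼_ : DecreasingTree s → DecreasingTree s → Set
  R ≼ T = ∀ a c → a < c → inv R c a ℕ.≤ inv T c a

  record TreeAscent (T : DecreasingTree s) (a c : Fin n) : Set where
    field
      a<c         : a < c
      descendant  : Descendant T a c
      notInRight  : ¬ a ∈ rightChild T c
      between     : ∀ b → a < b → b < c → Descendant T a b → a ∈ rightChild T b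
      emptyRight  : 0 ℕ.< s a → rightChild T a ≡ leaf

module _ {n : ℕ} where

  TransitivityPath : MultiSet n → Fin n → Fin n → Set
  TransitivityPath I = TransClosure (λ b b′ → b′ < b × 0 ℕ.< I b b′)

  firstMultiplicity : (I : MultiSet n) {c a : Fin n} → TransitivityPath I c a → ℕ
  firstMultiplicity I {c} {a} [ _ ]             = I c a
  firstMultiplicity I {c}     (_∷_ {y = b} _ _) = I c b

  -- J is the transitive closure of I.
  IsTransitiveClosure : MultiSet n → MultiSet n → Set
  IsTransitiveClosure I J = ∀ a c → a < c →
      (∃[ p ] firstMultiplicity I {c} {a} p ≡ J c a
              × (∀ q → firstMultiplicity I {c} {a} q ℕ.≤ J c a))
    ⊎ (¬ TransitivityPath I c a × J c a ≡ 0)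

  increase : MultiSet n → (Fin n → Fin n → Bool) → MultiSet n
  increase I A c a = I c a + (if A a c then 1 else 0)

module _ {n : ℕ} {s : WeakComposition n} where

  -- T₂ = T₁ + A.  A tree is determined by its tree-inversions, so this is
  -- expressed as an equality of multi-sets.
  IsSum : DecreasingTree s → (Fin n → Fin n → Bool) → DecreasingTree s → Set
  IsSum T₁ A T₂ = IsTransitiveClosure (increase (inv T₁) A) (inv T₂)

  -- The finite set A of pairs (a , c) is given by its characteristic function.
  PureInterval : DecreasingTree s → DecreasingTree s → Set
  PureInterval T₁ T₂ =
    ∃[ A ] (∀ a c → A a c ≡ true → TreeAscent T₁ a c) × IsSum T₁ A T₂

  Varies : (T₁ T₂ : DecreasingTree s) (c a : Fin n) → Set
  Varies T₁ T₂ c a = a < c × inv T₁ c a ℕ.< inv T₂ c a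

  amplitude : (T₁ T₂ : DecreasingTree s) (c a : Fin n) → ℕ
  amplitude T₁ T₂ c a = inv T₂ c a ∸ inv T₁ c a

  -- Var T₁ T₂ c a v says that (c , a)ᵥ is a variation; likewise EVar.
  Var : (T₁ T₂ : DecreasingTree s) (c a : Fin n) (v : ℕ) → Set
  Var T₁ T₂ c a v = Varies T₁ T₂ c a × v ≡ inv T₁ c a

  EVar : (T₁ T₂ : DecreasingTree s) (c a : Fin n) (v : ℕ) → Set
  EVar T₁ T₂ c a v = Var T₁ T₂ c a v ×
    ¬ (∃[ b ] a < b × b < c × InMiddleChild T₁ a b × Varies T₁ T₂ c b)

  PlusOneInterval : DecreasingTree s → DecreasingTree s → Set
  PlusOneInterval T₁ T₂ = ∀ c a v → Var T₁ T₂ c a v → amplitude T₁ T₂ c a ≡ 1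

{-# OPTIONS --safe #-}
module Submission where

-- Write I and J for the tree-inversions of T₁ and T₂.  Everything rests on a
-- few properties of the tree-inversions I of one tree, for a < b < c: they are
-- transitive (if I b a > 0 then I c b ≤ I c a) and planar (I c a ≤ I c b or
-- I b a = s b), a node larger than b does not distinguish b from the
-- descendants of b, and two nodes that are not nested are distinguished by a
-- common ancestor.
--
-- From a sum to the conditions.  Suppose T₂ = T₁ + A, and let I′ be I
-- increased along A.  Along an I′-path from b to a, the value seen from any
-- c > b increases weakly.  Hence (source) if (c , a) varies, then its amplitude
-- is one and some ascent (x , c) in A has I c x = I c a and either x = a or
-- a < x and J x a > 0.  In the second case I x a > 0 excludes I x a = s x
-- (below-ascent-not-right), so that a is in a middle child of x or (x , a)
-- varies with value 0; this allows induction on c.  It gives that a is a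
-- descendant of c whenever (c , a) varies, and then the two conditions.  For
-- the first (varies-upper), b is compared with the x of (c , a).  For the
-- second (essential-pair-varies), the ascents x and y of (c , a) and (c , b)
-- are compared.  If x ≠ y, the larger of them has s equal to 0, which is
-- excluded.  If x = y, then (x , a) varies with value 0, and either x = b or
-- (x , b) also varies with value 0, where the induction hypothesis applies.
--
-- From the conditions to a sum.  Call an essential variation (c , a) covered
-- if some b with a < b < c and s b ≠ 0 has (c , b) essential of the same
-- value.  The set A consists of the essential variations that are not covered.
-- These are tree-ascents (source-ascent): planarity of J and the first
-- condition give the requirement on the nodes between a and c, while the root
-- of a nonempty right child of a would contradict the second condition.  Since
-- J is transitive it bounds the transitive closure of I′.  Sufficiencyly, for
-- every variation (c , a) some I′-path from c to a begins with a step of the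
-- same value in A (reach): an inessential or covered variation (c , a) has a b
-- between a and c such that (c , b) varies with the same value and there is an
-- I′-path from b to a, given by a middle child or by the second condition.

open import Defs
open import Data.Bool using (Bool; true; false)
open import Data.Bool.Properties using (T-≡)
open import Data.Empty using (⊥-elim)
open import Data.Fin using (Fin; toℕ; fromℕ; _<_; _≤_; _>_)
open import Data.Fin.Induction using (<-wellFounded; >-wellFounded)
open import Data.Fin.Properties
  using (_≟_; _<?_; any?; <-cmp; toℕ-injective; toℕ-fromℕ; toℕ≤pred[n])
open import Data.Nat as ℕ using (ℕ; suc; z≤n)
import Data.Nat.Properties as ℕₚ
open import Data.Product using (_×_; _,_; ∃-syntax; proj₁; proj₂)
open import Data.Sum using (_⊎_; inj₁; inj₂)
open import Function.Bundles using (_⇔_; mk⇔; Equivalence)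
open import Induction.WellFounded using (Acc; acc)
open import Relation.Binary.Construct.Closure.Transitive using ([_]; _∷_; _++_)
open import Relation.Binary.Definitions using (tri<; tri≈; tri>)
open import Relation.Binary.PropositionalEquality using (_≡_; _≢_; refl; sym; trans; cong; subst)
open import Relation.Nullary using (¬_; Dec; yes; no)
open import Relation.Nullary.Decidable using (_×-dec_; ¬?; isYes; toWitness; fromWitness)

-- Positions of nodes in a tree

module _ {n : ℕ} {s : WeakComposition n} where

  -- The tree-inversion number of two given nodes of a tree that need not
  -- contain all labels, by recursion on that tree.  Only the case where the
  -- label of the second node is smaller matters, so the value 0 when the
  -- second node is the root is a default.
  mult : ∀ {t : Tree s} {c a} → c ∈ t → a ∈ t → ℕ
  mult here        here        = 0
  mult here        (there i _) = toℕ i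
  mult (there _ _) here        = 0
  mult {c = c} (there i p) (there j q) with <-cmp i j
  ... | tri< _ _ _    = s c
  ... | tri≈ _ refl _ = mult p q
  ... | tri> _ _ _    = 0

  mult-bound : ∀ {t : Tree s} {c a} (p : c ∈ t) (r : a ∈ t) → mult p r ℕ.≤ s c
  mult-bound here        here        = z≤n
  mult-bound here        (there i _) = toℕ≤pred[n] i
  mult-bound (there _ _) here        = z≤n
  mult-bound (there i p) (there j r) with <-cmp i j
  ... | tri< _ _ _    = ℕₚ.≤-refl
  ... | tri≈ _ refl _ = mult-bound p r
  ... | tri> _ _ _    = z≤n

  mult-transitive : ∀ {t : Tree s} {a b c} → Decreasing t →
    (p : c ∈ t) (q : b ∈ t) (r : a ∈ t) → a < b → b < c →
    0 ℕ.< mult q r → mult p q ℕ.≤ mult p r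
  mult-transitive dec here here r a<b b<c 0<qr = ⊥-elim (ℕₚ.<-irrefl refl b<c)
  mult-transitive dec here (there i q) here a<b b<c 0<qr =
    ⊥-elim (ℕₚ.<-asym a<b b<c)
  mult-transitive dec here (there i q) (there j r) a<b b<c 0<qr with <-cmp i j
  ... | tri< i<j _ _  = ℕₚ.<⇒≤ i<j
  ... | tri≈ _ refl _ = ℕₚ.≤-refl
  ... | tri> _ _ _    = ⊥-elim (ℕₚ.<-irrefl refl 0<qr)
  mult-transitive dec (there k p) here r a<b b<c 0<qr =
    ⊥-elim (ℕₚ.<-asym b<c (proj₁ (dec k) _ p))
  mult-transitive dec (there k p) (there i q) here a<b b<c 0<qr =
    ⊥-elim (ℕₚ.<-asym a<b (proj₁ (dec i) _ q))
  mult-transitive dec (there k p) (there i q) (there j r) a<b b<c 0<qr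
    with <-cmp k i | <-cmp i j | <-cmp k j
  ... | tri> _ _ _    | _              | _              = z≤n
  ... | tri< _ _ _    | tri> _ _ _     | _              = ⊥-elim (ℕₚ.<-irrefl refl 0<qr)
  ... | tri< _ _ _    | _              | tri< _ _ _     = ℕₚ.≤-refl
  ... | tri< k<i _ _  | tri< i<j _ _   | tri≈ ¬k<j _ _  = ⊥-elim (¬k<j (ℕₚ.<-trans k<i i<j))
  ... | tri< k<i _ _  | tri< i<j _ _   | tri> ¬k<j _ _  = ⊥-elim (¬k<j (ℕₚ.<-trans k<i i<j))
  ... | tri< k<i _ _  | tri≈ _ refl _  | tri≈ ¬k<j _ _  = ⊥-elim (¬k<j k<i)
  ... | tri< k<i _ _  | tri≈ _ refl _  | tri> ¬k<j _ _  = ⊥-elim (¬k<j k<i)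
  ... | tri≈ _ refl _ | tri> _ _ _     | _              = ⊥-elim (ℕₚ.<-irrefl refl 0<qr)
  ... | tri≈ _ refl _ | tri< _ _ _     | tri< _ _ _     = mult-bound p q
  ... | tri≈ _ refl _ | tri< i<j _ _   | tri≈ ¬k<j _ _  = ⊥-elim (¬k<j i<j)
  ... | tri≈ _ refl _ | tri< i<j _ _   | tri> ¬k<j _ _  = ⊥-elim (¬k<j i<j)
  ... | tri≈ _ refl _ | tri≈ _ refl _  | tri< _ k≢k _   = ⊥-elim (k≢k refl)
  ... | tri≈ _ refl _ | tri≈ _ refl _  | tri> _ k≢k _   = ⊥-elim (k≢k refl)
  ... | tri≈ _ refl _ | tri≈ _ refl _  | tri≈ _ refl _  =
    mult-transitive (proj₂ (dec k)) p q r a<b b<c 0<qr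

  mult-planar : ∀ {t : Tree s} {a b c} → Decreasing t →
    (p : c ∈ t) (q : b ∈ t) (r : a ∈ t) → a < b → b < c →
    mult p r ℕ.≤ mult p q ⊎ mult q r ≡ s b
  mult-planar dec here here r a<b b<c = ⊥-elim (ℕₚ.<-irrefl refl b<c)
  mult-planar dec here (there i q) here a<b b<c =
    ⊥-elim (ℕₚ.<-asym a<b b<c)
  mult-planar dec here (there i q) (there j r) a<b b<c with <-cmp i j
  ... | tri< _ _ _    = inj₂ refl
  ... | tri≈ _ refl _ = inj₁ ℕₚ.≤-refl
  ... | tri> _ _ j<i  = inj₁ (ℕₚ.<⇒≤ j<i)
  mult-planar dec (there k p) here r a<b b<c =
    ⊥-elim (ℕₚ.<-asym b<c (proj₁ (dec k) _ p))
  mult-planar dec (there k p) (there i q) here a<b b<c =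
    ⊥-elim (ℕₚ.<-asym a<b (proj₁ (dec i) _ q))
  mult-planar dec (there k p) (there i q) (there j r) a<b b<c
    with <-cmp k i | <-cmp i j | <-cmp k j
  ... | _             | _              | tri> _ _ _     = inj₁ z≤n
  ... | _             | tri< _ _ _     | _              = inj₂ refl
  ... | tri< _ _ _    | _              | tri< _ _ _     = inj₁ ℕₚ.≤-refl
  ... | tri< _ _ _    | _              | tri≈ _ refl _  = inj₁ (mult-bound p r)
  ... | tri≈ _ refl _ | tri> _ _ j<i   | tri< i<j _ _   = ⊥-elim (ℕₚ.<-asym i<j j<i)
  ... | tri≈ _ refl _ | tri≈ _ refl _  | tri< _ k≢k _   = ⊥-elim (k≢k refl)
  ... | tri≈ _ refl _ | tri> _ i≢j _   | tri≈ _ k≡j _   = ⊥-elim (i≢j k≡j)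
  ... | tri> _ _ i<k  | tri> _ _ j<i   | tri< k<j _ _   = ⊥-elim (ℕₚ.<-asym k<j (ℕₚ.<-trans j<i i<k))
  ... | tri> _ _ i<k  | tri> _ _ j<i   | tri≈ _ _ ¬j<k  = ⊥-elim (¬j<k (ℕₚ.<-trans j<i i<k))
  ... | tri> _ _ i<k  | tri≈ _ refl _  | tri< k<j _ _   = ⊥-elim (ℕₚ.<-asym k<j i<k)
  ... | tri> _ _ i<k  | tri≈ _ refl _  | tri≈ _ _ ¬i<k  = ⊥-elim (¬i<k i<k)
  ... | tri≈ _ refl _ | tri≈ _ refl _  | tri≈ _ refl _  =
    mult-planar (proj₂ (dec k)) p q r a<b b<c

  -- A node of a subtree, as a node of the whole tree.
  embed : ∀ {t : Tree s} {c a i} (p : c ∈ t) → a ∈ subtrees p i → a ∈ t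
  embed here        x = there _ x
  embed (there j p) x = there j (embed p x)

  subtrees-< : ∀ {t : Tree s} {c a i} → Decreasing t → (p : c ∈ t) →
    a ∈ subtrees p i → a < c
  subtrees-< dec here        x = proj₁ (dec _) _ x
  subtrees-< dec (there j p) x = subtrees-< (proj₂ (dec j)) p x

  subtrees-decreasing : ∀ {t : Tree s} {c} → Decreasing t → (p : c ∈ t) →
    ∀ i → Decreasing (subtrees p i)
  subtrees-decreasing dec here        i = proj₂ (dec i)
  subtrees-decreasing dec (there j p) i = subtrees-decreasing (proj₂ (dec j)) p i

  mult-child : ∀ {t : Tree s} {c a i} (p : c ∈ t) (x : a ∈ subtrees p i) →
    mult p (embed p x) ≡ toℕ i
  mult-child here        x = refl
  mult-child (there j p) x with <-cmp j j
  ... | tri< _ j≢j _  = ⊥-elim (j≢j refl)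
  ... | tri≈ _ refl _ = mult-child p x
  ... | tri> _ j≢j _  = ⊥-elim (j≢j refl)

  -- A node d larger than c sees a descendant of c in the same position as c.
  mult-descendant : ∀ {t : Tree s} {d c a i} → Decreasing t →
    (p : d ∈ t) (q : c ∈ t) (x : a ∈ subtrees q i) → c < d →
    mult p (embed q x) ≡ mult p q
  mult-descendant dec here        here        x c<d = ⊥-elim (ℕₚ.<-irrefl refl c<d)
  mult-descendant dec (there k p) here        x c<d =
    ⊥-elim (ℕₚ.<-asym c<d (proj₁ (dec k) _ p))
  mult-descendant dec here        (there j q) x c<d = refl
  mult-descendant dec (there k p) (there j q) x c<d with <-cmp k j
  ... | tri< _ _ _    = refl
  ... | tri≈ _ refl _ = mult-descendant (proj₂ (dec k)) p q x c<d
  ... | tri> _ _ _    = refl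

  -- Two nodes that are not nested lie in different subtrees of their lowest
  -- common ancestor.
  branching : ∀ {t : Tree s} {c a} → Decreasing t → (p : c ∈ t) (r : a ∈ t) → a < c →
      (∃[ i ] a ∈ subtrees p i)
    ⊎ (∃[ d ] ∃[ u ] ∃[ i ] ∃[ j ]
         toℕ i ≢ toℕ j × a ∈ subtrees {y = d} {t = t} u i × c ∈ subtrees u j)
  branching dec here        here        a<c = ⊥-elim (ℕₚ.<-irrefl refl a<c)
  branching dec here        (there i r) a<c = inj₁ (i , r)
  branching dec (there i p) here        a<c =
    ⊥-elim (ℕₚ.<-asym a<c (proj₁ (dec i) _ p))
  branching dec (there i p) (there j r) a<c with j ≟ i
  ... | no j≢i = inj₂ (_ , here , j , i , (λ e → j≢i (toℕ-injective e)) , r , p)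
  ... | yes refl with branching (proj₂ (dec j)) p r a<c
  ...   | inj₁ x = inj₁ x
  ...   | inj₂ (d , u , x) = inj₂ (d , there i u , x)

  mult-right : ∀ {t : Tree s} {c a} → LeftOf c a t →
    ∃[ p ] ∃[ r ] mult {t} {c} {a} p r ≡ s c
  mult-right (split i j i<j p r) = there i p , there j r , eq
    where
    eq : mult (there i p) (there j r) ≡ s _
    eq with <-cmp i j
    ... | tri< _ _ _    = refl
    ... | tri≈ ¬i<j _ _ = ⊥-elim (¬i<j i<j)
    ... | tri> ¬i<j _ _ = ⊥-elim (¬i<j i<j)
  mult-right (inside {ts = ts} i l) with mult-right l
  ... | p , r , e = there i p , there i r , eq
    where
    eq : mult {node _ ts} (there i p) (there i r) ≡ s _
    eq with <-cmp i i
    ... | tri< _ i≢i _  = ⊥-elim (i≢i refl)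
    ... | tri≈ _ refl _ = e
    ... | tri> _ i≢i _  = ⊥-elim (i≢i refl)

  mult-left : ∀ {t : Tree s} {c a} → Decreasing t → (p : c ∈ t) (r : a ∈ t) → a < c →
    ¬ (∃[ i ] a ∈ subtrees p i) → ¬ LeftOf c a t → mult p r ≡ 0
  mult-left dec here        here        a<c ¬d ¬l = refl
  mult-left dec here        (there i r) a<c ¬d ¬l = ⊥-elim (¬d (i , r))
  mult-left dec (there i p) here        a<c ¬d ¬l = refl
  mult-left dec (there i p) (there j r) a<c ¬d ¬l with <-cmp i j
  ... | tri< i<j _ _  = ⊥-elim (¬l (split i j i<j p r))
  ... | tri≈ _ refl _ = mult-left (proj₂ (dec i)) p r a<c ¬d (λ l → ¬l (inside i l))
  ... | tri> _ _ _    = refl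

  leaf-or-largest : (t : Tree s) → Decreasing t →
    t ≡ leaf ⊎ (∃[ y ] y ∈ t × (∀ b → b ∈ t → b ≤ y))
  leaf-or-largest leaf        dec = inj₁ refl
  leaf-or-largest (node y ts) dec = inj₂ (y , here , largest)
    where
    largest : ∀ b → b ∈ node y ts → b ≤ y
    largest b here        = ℕₚ.≤-refl
    largest b (there i x) = ℕₚ.<⇒≤ (proj₁ (dec i) b x)

-- Properties of tree-inversions

module TreeInversions {n : ℕ} {s : WeakComposition n} (T : DecreasingTree s) where

  open DecreasingTree T

  -- The nodes p and r are arbitrary: by uniqueness they are the nodes chosen
  -- in the definition of inv.
  inv≡mult : ∀ {c a} → a < c → (p : c ∈ tree) (r : a ∈ tree) → inv T c a ≡ mult p r
  inv≡mult {c} {a} a<c p r with unique p (nodeOf c)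
  ... | refl with any? (λ i → a ∈? child T c i) | leftOf? c a tree
  ...   | yes (i , x) | _     with unique r (embed (nodeOf c) x)
  ...     | refl = sym (mult-child (nodeOf c) x)
  inv≡mult {c} {a} a<c p r | refl | no _ | yes l with mult-right l
  ... | p′ , r′ , e with unique p′ (nodeOf c) | unique r′ r
  ...   | refl | refl = sym e
  inv≡mult {c} {a} a<c p r | refl | no ¬d | no ¬l =
    sym (mult-left decreasing (nodeOf c) r a<c ¬d ¬l)

  bound : ∀ {a c} → a < c → inv T c a ℕ.≤ s c
  bound {a} {c} a<c =
    subst (ℕ._≤ s c) (sym (inv≡mult a<c (nodeOf c) (nodeOf a))) (mult-bound (nodeOf c) (nodeOf a))

  transitive : ∀ {a b c} → a < b → b < c → 0 ℕ.< inv T b a → inv T c b ℕ.≤ inv T c a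
  transitive {a} {b} {c} a<b b<c
    rewrite inv≡mult a<b (nodeOf b) (nodeOf a)
          | inv≡mult b<c (nodeOf c) (nodeOf b)
          | inv≡mult (ℕₚ.<-trans a<b b<c) (nodeOf c) (nodeOf a)
    = mult-transitive decreasing (nodeOf c) (nodeOf b) (nodeOf a) a<b b<c

  planar : ∀ {a b c} → a < b → b < c → inv T c a ℕ.≤ inv T c b ⊎ inv T b a ≡ s b
  planar {a} {b} {c} a<b b<c
    rewrite inv≡mult a<b (nodeOf b) (nodeOf a)
          | inv≡mult b<c (nodeOf c) (nodeOf b)
          | inv≡mult (ℕₚ.<-trans a<b b<c) (nodeOf c) (nodeOf a)
    = mult-planar decreasing (nodeOf c) (nodeOf b) (nodeOf a) a<b b<c

  child-< : ∀ {c a i} → a ∈ child T c i → a < c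
  child-< {c} = subtrees-< decreasing (nodeOf c)

  child-inv : ∀ {c a i} → a ∈ child T c i → inv T c a ≡ toℕ i
  child-inv {c} x =
    trans (inv≡mult (child-< x) (nodeOf c) (embed (nodeOf c) x)) (mult-child (nodeOf c) x)

  descendant-< : ∀ {a c} → Descendant T a c → a < c
  descendant-< (i , x) = child-< x

  descendant-inv : ∀ {a c d} → Descendant T a c → c < d → inv T d a ≡ inv T d c
  descendant-inv {a} {c} {d} (i , x) c<d =
    trans (inv≡mult (ℕₚ.<-trans (child-< x) c<d) (nodeOf d) (embed (nodeOf c) x))
      (trans (mult-descendant decreasing (nodeOf d) (nodeOf c) x c<d)
        (sym (inv≡mult c<d (nodeOf d) (nodeOf c))))

  -- Two nodes that are not nested have different positions with respect to
  -- their lowest common ancestor.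
  nested-or-separated : ∀ {a c} → a < c → Descendant T a c ⊎
    (∃[ d ] Descendant T a d × Descendant T c d × inv T d a ≢ inv T d c)
  nested-or-separated {a} {c} a<c with branching decreasing (nodeOf c) (nodeOf a) a<c
  ... | inj₁ x = inj₁ x
  ... | inj₂ (d , u , i , j , i≢j , x , y) with unique u (nodeOf d)
  ...   | refl = inj₂ (d , (i , x) , (j , y) ,
            λ e → i≢j (trans (sym (child-inv x)) (trans e (child-inv y))))

  -- Together with descendant-inv, this characterises descendants by
  -- tree-inversions.
  descendant-from-inv : ∀ {a c} → a < c →
    (∀ {d} → c < d → inv T d a ≡ inv T d c) → Descendant T a c
  descendant-from-inv a<c eq with nested-or-separated a<c
  ... | inj₁ x = x
  ... | inj₂ (d , _ , c∈d , ≢) = ⊥-elim (≢ (eq (descendant-< c∈d)))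

  descendant-trans : ∀ {a b c} → Descendant T a b → Descendant T b c → Descendant T a c
  descendant-trans {a} {b} {c} ab bc =
    descendant-from-inv (ℕₚ.<-trans a<b b<c)
      λ c<d → trans (descendant-inv ab (ℕₚ.<-trans b<c c<d)) (descendant-inv bc c<d)
    where
    a<b : a < b
    a<b = descendant-< ab
    b<c : b < c
    b<c = descendant-< bc

  ancestors-nested : ∀ {a b c} → b < c → Descendant T a b → Descendant T a c → Descendant T b c
  ancestors-nested b<c ab ac =
    descendant-from-inv b<c
      λ c<d → trans (sym (descendant-inv ab (ℕₚ.<-trans b<c c<d))) (descendant-inv ac c<d)

  -- A node in a middle position is a descendant: other nodes are at the
  -- extreme positions.
  inMiddleChild : ∀ {a c} → 0 ℕ.< inv T c a → inv T c a ℕ.< s c → InMiddleChild T a c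
  inMiddleChild {a} {c} 0<v v<s with any? (λ i → a ∈? child T c i) | leftOf? c a tree
  ... | yes (i , x) | _     = i , 0<v , v<s , x
  ... | no _        | yes _ = ⊥-elim (ℕₚ.<-irrefl refl v<s)
  ... | no _        | no _  = ⊥-elim (ℕₚ.<-irrefl refl 0<v)

  middle-inv : ∀ {a c} → InMiddleChild T a c →
    Descendant T a c × 0 ℕ.< inv T c a × inv T c a ℕ.< s c
  middle-inv (i , 0<i , i<s , x) rewrite child-inv x = (i , x) , 0<i , i<s

  rightChild-inv : ∀ {a c} → a ∈ rightChild T c → inv T c a ≡ s c
  rightChild-inv x = trans (child-inv x) (toℕ-fromℕ _)

  inRightChild : ∀ {a c} → Descendant T a c → inv T c a ≡ s c → a ∈ rightChild T c
  inRightChild {a} {c} (i , x) v≡s =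
    subst (λ j → a ∈ child T c j)
      (toℕ-injective (trans (sym (child-inv x)) (trans v≡s (sym (toℕ-fromℕ (s c)))))) x

  -- Tree-ascents

  not-in-leaf : ∀ {t : Tree s} {a} → a ∈ t → t ≢ leaf
  not-in-leaf () refl

  ascent-value : ∀ {a c} → TreeAscent T a c → inv T c a ℕ.< s c
  ascent-value asc =
    ℕₚ.≤∧≢⇒< (bound a<c) λ v≡s → notInRight (inRightChild descendant v≡s)
    where open TreeAscent asc

  -- The right child of x is empty if s x > 0, so I x a = s x > 0 would put a to
  -- the right of x.  No such node has the same value at c as x, because x is in
  -- the right child of each of its ancestors below c.
  below-ascent-not-right : ∀ {a x c} → TreeAscent T x c → a < x → inv T c x ≡ inv T c a →
    0 ℕ.< inv T x a → inv T x a ≢ s x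
  below-ascent-not-right {a} {x} {c} asc a<x cx≡ca 0<xa xa≡s
    with nested-or-separated a<x
  ... | inj₁ ax =
    not-in-leaf (inRightChild ax xa≡s)
      (TreeAscent.emptyRight asc (subst (0 ℕ.<_) xa≡s 0<xa))
  ... | inj₂ (d , ad , xd , da≢dx) with <-cmp d c
  ...   | tri< d<c _ _  = da≢dx (ℕₚ.≤-antisym
            (subst (inv T d a ℕ.≤_) (sym dx≡s) (bound (descendant-< ad)))
            (transitive a<x (descendant-< xd) 0<xa))
    where
    dx≡s : inv T d x ≡ s d
    dx≡s = rightChild-inv (TreeAscent.between asc d (descendant-< xd) d<c xd)
  ...   | tri≈ _ refl _ = da≢dx (sym cx≡ca)
  ...   | tri> _ _ c<d  with planar (ℕₚ.<-trans a<x (TreeAscent.a<c asc)) c<d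
  ...     | inj₁ da≤dc = da≢dx (ℕₚ.≤-antisym
            (subst (inv T d a ℕ.≤_) (sym (descendant-inv (TreeAscent.descendant asc) c<d)) da≤dc)
            (transitive a<x (descendant-< xd) 0<xa))
  ...     | inj₂ ca≡s  = ℕₚ.<-irrefl (trans cx≡ca ca≡s) (ascent-value asc)

  -- Two ascents in the same child of c are nested, the smaller one in the right
  -- child of the larger one, and that child is empty unless s y = 0.
  upper-ascent-unary : ∀ {x y c} → TreeAscent T x c → TreeAscent T y c →
    inv T c x ≡ inv T c y → x < y → s y ≡ 0
  upper-ascent-unary {x} {y} {c} ascx ascy cx≡cy x<y with nested-or-separated x<y
  ... | inj₁ xy = ℕₚ.n≤0⇒n≡0 (ℕₚ.≮⇒≥ λ 0<s →
    not-in-leaf (TreeAscent.between ascx y x<y (TreeAscent.a<c ascy) xy)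
      (TreeAscent.emptyRight ascy 0<s))
  ... | inj₂ (d , xd , yd , dx≢dy) with <-cmp d c
  ...   | tri< d<c _ _  = ⊥-elim (dx≢dy (trans (right ascx xd) (sym (right ascy yd))))
    where
    right : ∀ {z} → TreeAscent T z c → Descendant T z d → inv T d z ≡ s d
    right asc zd = rightChild-inv (TreeAscent.between asc d (descendant-< zd) d<c zd)
  ...   | tri≈ _ refl _ = ⊥-elim (dx≢dy cx≡cy)
  ...   | tri> _ _ c<d  = ⊥-elim (dx≢dy (trans (descendant-inv (TreeAscent.descendant ascx) c<d)
                            (sym (descendant-inv (TreeAscent.descendant ascy) c<d))))

-- Multi-sets and transitivity paths

module Increase {n : ℕ} (I : MultiSet n) (A : Fin n → Fin n → Bool) where

  increase-true : ∀ {a c} → A a c ≡ true → increase I A c a ≡ suc (I c a)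
  increase-true {a} {c} e rewrite e = ℕₚ.+-comm (I c a) 1

  increase-cases : ∀ a c →
    (A a c ≡ true × increase I A c a ≡ suc (I c a)) ⊎ increase I A c a ≡ I c a
  increase-cases a c with A a c
  ... | true  = inj₁ (refl , ℕₚ.+-comm (I c a) 1)
  ... | false = inj₂ (ℕₚ.+-identityʳ (I c a))

  increase-≥ : ∀ {a c} → I c a ℕ.≤ increase I A c a
  increase-≥ = ℕₚ.m≤m+n _ _

module _ {n : ℕ} {I : MultiSet n} where

  path-< : ∀ {a c} → TransitivityPath I c a → a < c
  path-< [ (a<c , _) ]     = a<c
  path-< ((b<c , _) ∷ p) = ℕₚ.<-trans (path-< p) b<c

  firstMultiplicity-positive : ∀ {a c} (p : TransitivityPath I c a) → 0 ℕ.< firstMultiplicity I p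
  firstMultiplicity-positive [ (_ , 0<) ]   = 0<
  firstMultiplicity-positive ((_ , 0<) ∷ _) = 0<

-- Variations of an interval

module Variations {n : ℕ} {s : WeakComposition n} (T₁ T₂ : DecreasingTree s) where

  I J : MultiSet n
  I = inv T₁
  J = inv T₂

  module T₁ = TreeInversions T₁
  module T₂ = TreeInversions T₂

  -- A variation (c , a) is essential exactly if this fails.
  Inessential : (c a : Fin n) → Set
  Inessential c a = ∃[ b ] a < b × b < c × InMiddleChild T₁ a b × Varies T₁ T₂ c b

-- Conditions satisfied by a pure interval

module Necessity {n : ℕ} {s : WeakComposition n} (T₁ T₂ : DecreasingTree s)
  (T₁≼T₂ : T₁ ≼ T₂)
  (A : Fin n → Fin n → Bool)
  (ascents : ∀ a c → A a c ≡ true → TreeAscent T₁ a c)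
  (isSum : IsSum T₁ A T₂) where

  open Variations T₁ T₂
  open Increase I A

  Path : Fin n → Fin n → Set
  Path = TransitivityPath (increase I A)

  step-≤ : ∀ {a b c} → a < b → 0 ℕ.< increase I A b a → b < c → I c b ℕ.≤ I c a
  step-≤ {a} {b} {c} a<b 0<ba b<c with increase-cases a b
  ... | inj₁ (Aab , _) =
    ℕₚ.≤-reflexive (sym (T₁.descendant-inv (TreeAscent.descendant (ascents a b Aab)) b<c))
  ... | inj₂ e         = T₁.transitive a<b b<c (subst (0 ℕ.<_) e 0<ba)

  -- The value seen from a larger node increases weakly along a path.
  path-≤ : ∀ {a b c} → Path b a → b < c → I c b ℕ.≤ I c a
  path-≤ [ (a<b , 0<ba) ] b<c = step-≤ a<b 0<ba b<c
  path-≤ ((d<b , 0<bd) ∷ p) b<c =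
    ℕₚ.≤-trans (step-≤ d<b 0<bd b<c) (path-≤ p (ℕₚ.<-trans d<b b<c))

  path-bound : ∀ {a c} (p : Path c a) → firstMultiplicity (increase I A) p ℕ.≤ J c a
  path-bound {a} {c} p with isSum a c (path-< p)
  ... | inj₁ (_ , _ , max) = max p
  ... | inj₂ (¬p , _)      = ⊥-elim (¬p p)

  path-positive : ∀ {a c} → Path c a → 0 ℕ.< J c a
  path-positive p = ℕₚ.≤-trans (firstMultiplicity-positive p) (path-bound p)

  module Ascent {a c} (Aac : A a c ≡ true) = TreeAscent (ascents a c Aac)

  ascent-J : ∀ {a c} → A a c ≡ true → I c a ℕ.< J c a
  ascent-J {a} {c} Aac = ℕₚ.≤-trans (ℕₚ.≤-reflexive (sym e))
    (path-bound [ Ascent.a<c Aac , subst (0 ℕ.<_) (sym e) ℕₚ.0<1+n ])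
    where
    e : increase I A c a ≡ suc (I c a)
    e = increase-true Aac

  -- In T₂, node a is at x or is reached from x.
  Below : (x a : Fin n) → Set
  Below x a = x ≡ a ⊎ (a < x × 0 ℕ.< J x a)

  -- The ascent at which a path of maximal first multiplicity begins.
  source : ∀ {a c} → Varies T₁ T₂ c a → J c a ≡ suc (I c a) ×
    (∃[ x ] A x c ≡ true × I c x ≡ I c a × Below x a)
  source {a} {c} (a<c , v) with isSum a c a<c
  ... | inj₂ (_ , J≡0) = ⊥-elim (ℕₚ.n≮0 (subst (I c a ℕ.<_) J≡0 v))
  ... | inj₁ ([ _ ] , e , _) with increase-cases a c
  ...   | inj₂ e′         = ⊥-elim (ℕₚ.<-irrefl (trans (sym e′) e) v)
  ...   | inj₁ (Aac , e′) = trans (sym e) e′ , a , Aac , refl , inj₁ refl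
  source {a} {c} (a<c , v) | inj₁ (_∷_ {y = b} (b<c , _) p , e , _) with increase-cases b c
  ...   | inj₂ e′         =
    ⊥-elim (ℕₚ.<⇒≱ v (ℕₚ.≤-trans (ℕₚ.≤-reflexive (trans (sym e) e′)) (path-≤ p b<c)))
  ...   | inj₁ (Abc , e′) =
    trans J≡ (cong suc b≡a) , b , Abc , b≡a , inj₂ (path-< p , path-positive p)
    where
    J≡ : J c a ≡ suc (I c b)
    J≡ = trans (sym e) e′
    b≡a : I c b ≡ I c a
    b≡a = ℕₚ.≤-antisym (path-≤ p b<c) (ℕ.s≤s⁻¹ (subst (I c a ℕ.<_) J≡ v))

  plusOne : PlusOneInterval T₁ T₂
  plusOne c a v (var , _) =
    trans (cong (ℕ._∸ I c a) (proj₁ (source var))) (ℕₚ.m+n∸n≡m 1 (I c a))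

  -- How a node a that is reached from an ascent x lies with respect to x.
  below-ascent : ∀ {a x c} → A x c ≡ true → I c x ≡ I c a → a < x → 0 ℕ.< J x a →
    (Varies T₁ T₂ x a × 0 ≡ I x a) ⊎ InMiddleChild T₁ a x
  below-ascent {a} {x} {c} Axc e a<x 0<J with 0 ℕ.<? I x a
  ... | yes 0<I = inj₂ (T₁.inMiddleChild 0<I
          (ℕₚ.≤∧≢⇒< (T₁.bound a<x) (T₁.below-ascent-not-right (ascents x c Axc) a<x e 0<I)))
  ... | no ¬0<I = inj₁ ((a<x , subst (ℕ._< J x a) I≡0 0<J) , I≡0)
    where
    I≡0 : 0 ≡ I x a
    I≡0 = sym (ℕₚ.n≤0⇒n≡0 (ℕₚ.≮⇒≥ ¬0<I))

  -- By induction on c: a is below the ascent x given by source, and x is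
  -- below c.
  variation-descendant′ : ∀ {a c} → Acc _<_ c → Varies T₁ T₂ c a → Descendant T₁ a c
  variation-descendant′ (acc rs) var with source var
  ... | _ , x , Axc , _ , inj₁ refl = Ascent.descendant Axc
  ... | _ , x , Axc , e , inj₂ (a<x , 0<J) =
    T₁.descendant-trans ax (Ascent.descendant Axc)
    where
    ax : Descendant T₁ _ x
    ax with below-ascent Axc e a<x 0<J
    ... | inj₁ (var′ , _) = variation-descendant′ (rs (Ascent.a<c Axc)) var′
    ... | inj₂ mid        = proj₁ (T₁.middle-inv mid)

  variation-descendant : ∀ {a c} → Varies T₁ T₂ c a → Descendant T₁ a c
  variation-descendant = variation-descendant′ (<-wellFounded _)

  below-ascent-descendant : ∀ {a x c} → A x c ≡ true → I c x ≡ I c a → a < x → 0 ℕ.< J x a →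
    Descendant T₁ a x
  below-ascent-descendant Axc e a<x 0<J with below-ascent Axc e a<x 0<J
  ... | inj₁ (var , _) = variation-descendant var
  ... | inj₂ mid       = proj₁ (T₁.middle-inv mid)

  below-ascent-varies : ∀ {b x c} → A x c ≡ true → I c x ≡ I c b → b < x → 0 ℕ.< J x b →
    Varies T₁ T₂ c b
  below-ascent-varies {b} {x} {c} Axc e b<x 0<J =
    ℕₚ.<-trans b<x x<c ,
    ℕₚ.≤-trans (subst (ℕ._< J c x) e (ascent-J Axc)) (T₂.transitive b<x x<c 0<J)
    where
    x<c : x < c
    x<c = Ascent.a<c Axc

  -- Let x be the ascent of (c , a).  If x < b, then a is in the right child of b
  -- and (b , a) cannot vary.  If x = b, then (c , b) is itself increased.  If
  -- x > b, then (x , b) has positive multiplicity in T₂, in one case by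
  -- induction, and so (c , b) varies along with (c , x).
  varies-upper : ∀ {a b c} → Acc _<_ c → a < b → b < c →
    Varies T₁ T₂ c a → Varies T₁ T₂ b a → Varies T₁ T₂ c b
  varies-upper {a} {b} {c} (acc rs) a<b b<c vca vba with source vca
  ... | _ , x , Axc , e , below = goal (<-cmp x b) below
    where
    ab : Descendant T₁ a b
    ab = variation-descendant vba

    x-below-b : x < b → Descendant T₁ x b → I b x ≢ I b a
    x-below-b x<b xb bx≡ba = ℕₚ.<⇒≱ (proj₂ vba)
      (ℕₚ.≤-trans (T₂.bound a<b) (ℕₚ.≤-reflexive
        (trans (sym (T₁.rightChild-inv (Ascent.between Axc b x<b b<c xb))) bx≡ba)))

    goal : _ → Below x a → Varies T₁ T₂ c b
    goal (tri≈ _ refl _) _ = Ascent.a<c Axc , ascent-J Axc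
    goal (tri< x<b _ _) (inj₁ refl) = ⊥-elim (x-below-b x<b ab refl)
    goal (tri< x<b _ _) (inj₂ (a<x , 0<J)) =
      ⊥-elim (x-below-b x<b (T₁.ancestors-nested x<b ax ab) (sym (T₁.descendant-inv ax x<b)))
      where
      ax : Descendant T₁ a x
      ax = below-ascent-descendant Axc e a<x 0<J
    goal (tri> _ _ b<x) (inj₁ refl) = ⊥-elim (ℕₚ.<-asym a<b b<x)
    goal (tri> _ _ b<x) (inj₂ (a<x , 0<Jxa)) =
      below-ascent-varies Axc (trans e (T₁.descendant-inv ab b<c)) b<x 0<Jxb
      where
      0<Jxb : 0 ℕ.< J x b
      0<Jxb with below-ascent Axc e a<x 0<Jxa
      ... | inj₁ (vxa , _) =
        ℕₚ.≤-trans ℕₚ.0<1+n (proj₂ (varies-upper (rs (Ascent.a<c Axc)) a<b b<x vxa vba))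
      ... | inj₂ mid = ℕₚ.≤-trans
        (subst (0 ℕ.<_) (T₁.descendant-inv ab b<x) (proj₁ (proj₂ (T₁.middle-inv mid))))
        (T₁≼T₂ b x b<x)

  -- An essential variation (c , a) with x ≠ a comes from an essential variation
  -- (x , a) of value 0.
  below-ascent-essential : ∀ {a x c} → A x c ≡ true → I c x ≡ I c a → a < x → 0 ℕ.< J x a →
    ¬ Inessential c a → EVar T₁ T₂ x a 0
  below-ascent-essential {a} {x} {c} Axc e a<x 0<J ess
    with below-ascent Axc e a<x 0<J
  ... | inj₂ mid = ⊥-elim (ess (x , a<x , Ascent.a<c Axc , mid , Ascent.a<c Axc , ascent-J Axc))
  ... | inj₁ var = var , λ { (d , a<d , d<x , mid , _ , vxd) →
    ess (d , a<d , ℕₚ.<-trans d<x (Ascent.a<c Axc) , mid ,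
      below-ascent-varies Axc
        (trans e (T₁.descendant-inv (proj₁ (T₁.middle-inv mid)) (ℕₚ.<-trans d<x (Ascent.a<c Axc))))
        d<x (ℕₚ.≤-trans ℕₚ.0<1+n vxd)) }

  -- The ascents x of (c , a) and y of (c , b) have the same value, so by
  -- upper-ascent-unary the larger one, if they differ, is a node z with s z = 0.
  -- It is not b, and no (z , d) varies.
  essential-pair-varies : ∀ {a b c v} → Acc _<_ c → a < b → b < c →
    EVar T₁ T₂ c a v → EVar T₁ T₂ c b v → s b ≢ 0 → Var T₁ T₂ b a 0
  essential-pair-varies {a} {b} {c} (acc rs) a<b b<c ((vca , va) , essa) ((vcb , vb) , essb) sb≢0
    with source vca | source vcb
  ... | _ , x , Axc , ex , belowx | _ , y , Ayc , ey , belowy = goal (<-cmp x y) belowx belowy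
    where
    xy : I c x ≡ I c y
    xy = trans ex (trans (sym va) (trans vb (sym ey)))

    nonunary : ∀ {z d} → Varies T₁ T₂ z d → s z ≢ 0
    nonunary {z} {d} (d<z , v) sz≡0 =
      ℕₚ.n≮0 (subst (I z d ℕ.<_) sz≡0 (ℕₚ.≤-trans v (T₂.bound d<z)))

    goal : _ → Below x a → Below y b → Var T₁ T₂ b a 0
    goal (tri< x<y _ _) _ (inj₁ refl) =
      ⊥-elim (sb≢0 (T₁.upper-ascent-unary (ascents _ _ Axc) (ascents _ _ Ayc) xy x<y))
    goal (tri< x<y _ _) _ (inj₂ (b<y , 0<J)) =
      ⊥-elim (nonunary (proj₁ (proj₁ (below-ascent-essential Ayc ey b<y 0<J essb)))
        (T₁.upper-ascent-unary (ascents _ _ Axc) (ascents _ _ Ayc) xy x<y))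
    goal (tri> _ _ y<x) (inj₁ refl) (inj₁ refl) = ⊥-elim (ℕₚ.<-asym a<b y<x)
    goal (tri> _ _ y<x) (inj₁ refl) (inj₂ (b<y , _)) = ⊥-elim (ℕₚ.<-asym a<b (ℕₚ.<-trans b<y y<x))
    goal (tri> _ _ y<x) (inj₂ (a<x , 0<J)) _ =
      ⊥-elim (nonunary (proj₁ (proj₁ (below-ascent-essential Axc ex a<x 0<J essa)))
        (T₁.upper-ascent-unary (ascents _ _ Ayc) (ascents _ _ Axc) (sym xy) y<x))
    goal (tri≈ _ refl _) (inj₁ refl) (inj₁ refl) = ⊥-elim (ℕₚ.<-irrefl refl a<b)
    goal (tri≈ _ refl _) (inj₁ refl) (inj₂ (b<x , _)) = ⊥-elim (ℕₚ.<-asym a<b b<x)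
    goal (tri≈ _ refl _) (inj₂ (a<x , 0<J)) (inj₁ refl) =
      proj₁ (below-ascent-essential Axc ex a<x 0<J essa)
    goal (tri≈ _ refl _) (inj₂ (a<x , 0<Jxa)) (inj₂ (b<x , 0<Jxb)) =
      essential-pair-varies (rs (Ascent.a<c Axc)) a<b b<x
        (below-ascent-essential Axc ex a<x 0<Jxa essa)
        (below-ascent-essential Axc ey b<x 0<Jxb essb) sb≢0

-- Intervals satisfying the conditions are pure

module Sufficiency {n : ℕ} {s : WeakComposition n} (T₁ T₂ : DecreasingTree s)
  (T₁≼T₂ : T₁ ≼ T₂)
  (plusOne : PlusOneInterval T₁ T₂)
  (varies-upper : ∀ (a b c : Fin n) → a < b → b < c → ∀ (v w : ℕ) →
    Var T₁ T₂ c a v → Var T₁ T₂ b a w → Var T₁ T₂ c b v)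
  (essential-pair-varies : ∀ (a b c : Fin n) → a < b → b < c → ∀ (v : ℕ) →
    EVar T₁ T₂ c a v → EVar T₁ T₂ c b v → s b ≢ 0 → Var T₁ T₂ b a 0) where

  open Variations T₁ T₂

  varies? : ∀ c a → Dec (Varies T₁ T₂ c a)
  varies? c a = (a <? c) ×-dec (I c a ℕ.<? J c a)

  inessential? : ∀ c a → Dec (Inessential c a)
  inessential? c a = any? λ b → (a <? b) ×-dec ((b <? c) ×-dec (middle? b ×-dec varies? c b))
    where
    middle? : ∀ b → Dec (InMiddleChild T₁ a b)
    middle? b = any? λ i → (0 ℕ.<? toℕ i) ×-dec ((toℕ i ℕ.<? s b) ×-dec (a ∈? child T₁ b i))

  -- The variation (c , a) is essential, its value I c a being left implicit.
  Essential : (c a : Fin n) → Set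
  Essential c a = Varies T₁ T₂ c a × ¬ Inessential c a

  essential? : ∀ c a → Dec (Essential c a)
  essential? c a = varies? c a ×-dec ¬? (inessential? c a)

  -- Some b with s b ≠ 0 to which, together with a, the second condition applies
  -- at c.
  Covered : (c a : Fin n) → Set
  Covered c a = ∃[ b ] a < b × b < c × Essential c b × I c b ≡ I c a × s b ≢ 0

  covered? : ∀ c a → Dec (Covered c a)
  covered? c a = any? λ b → (a <? b) ×-dec ((b <? c) ×-dec
    (essential? c b ×-dec ((I c b ℕ.≟ I c a) ×-dec ¬? (s b ℕ.≟ 0))))

  -- The pairs along which T₁ is increased, in the order of tree-ascents.
  Source : (a c : Fin n) → Set
  Source a c = Essential c a × ¬ Covered c a

  source? : ∀ a c → Dec (Source a c)
  source? a c = essential? c a ×-dec ¬? (covered? c a)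

  -- The characteristic function of Source, used only through the two lemmas
  -- that follow it.
  abstract
    A : Fin n → Fin n → Bool
    A a c = isYes (source? a c)

    A-sound : ∀ {a c} → A a c ≡ true → Source a c
    A-sound {a} {c} e = toWitness {a? = source? a c} (Equivalence.from T-≡ e)

    A-complete : ∀ {a c} → Source a c → A a c ≡ true
    A-complete {a} {c} src = Equivalence.to T-≡ (fromWitness {a? = source? a c} src)

  open Increase I A

  source-increase : ∀ {a c} → Source a c → increase I A c a ≡ suc (I c a)
  source-increase {a} {c} src = increase-true (A-complete src)

  varies-J : ∀ {c a} → Varies T₁ T₂ c a → J c a ≡ suc (I c a)
  varies-J {c} {a} var@(a<c , I<J) =
    trans (sym (ℕₚ.m∸n+n≡m (ℕₚ.<⇒≤ I<J))) (cong (ℕ._+ I c a) (plusOne c a _ (var , refl)))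

  constant-J : ∀ {c a} → a < c → ¬ Varies T₁ T₂ c a → J c a ≡ I c a
  constant-J {c} {a} a<c ¬v = ℕₚ.≤-antisym (ℕₚ.≮⇒≥ λ I<J → ¬v (a<c , I<J)) (T₁≼T₂ a c a<c)

  varies-value : ∀ {c a} → Varies T₁ T₂ c a → I c a ℕ.< s c
  varies-value (a<c , I<J) = ℕₚ.≤-trans I<J (T₂.bound a<c)

  -- Otherwise a common ancestor d separates a from c, and a is left of c.  As
  -- (c , a) is present in T₂, the pair (d , a) varies, and the first condition
  -- forces a and c into the same child of d.
  variation-descendant : ∀ {c a} → Varies T₁ T₂ c a → Descendant T₁ a c
  variation-descendant {c} {a} vca@(a<c , I<J) with T₁.nested-or-separated a<c
  ... | inj₁ ac = ac
  ... | inj₂ (d , ad , cd , da≢dc) = ⊥-elim (da≢dc (sym dc≡da))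
    where
    c<d : c < d
    c<d = T₁.descendant-< cd
    da<dc : I d a ℕ.< I d c
    da<dc with T₁.planar a<c c<d
    ... | inj₁ da≤dc = ℕₚ.≤∧≢⇒< da≤dc da≢dc
    ... | inj₂ ca≡s  = ⊥-elim (ℕₚ.<-irrefl ca≡s (varies-value vca))
    vda : Varies T₁ T₂ d a
    vda = ℕₚ.<-trans a<c c<d , ℕₚ.≤-trans da<dc
      (ℕₚ.≤-trans (T₁≼T₂ c d c<d) (T₂.transitive a<c c<d (ℕₚ.≤-trans ℕₚ.0<1+n I<J)))
    dc≡da : I d c ≡ I d a
    dc≡da = sym (proj₂ (varies-upper a c d a<c c<d _ _ (vda , refl) (vca , refl)))

  -- An essential variation that is not covered is a tree-ascent.
  module _ {x c : Fin n} (src : Source x c) where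

    vcx : Varies T₁ T₂ c x
    vcx = proj₁ (proj₁ src)

    x<c : x < c
    x<c = proj₁ vcx

    xc : Descendant T₁ x c
    xc = variation-descendant vcx

    -- Otherwise (c , b) is an essential variation that covers (c , x).
    source-between : ∀ b → x < b → b < c → Descendant T₁ x b → x ∈ rightChild T₁ b
    source-between b x<b b<c xb with I b x ℕ.≟ s b
    ... | yes bx≡s = T₁.inRightChild xb bx≡s
    ... | no bx≢s  = ⊥-elim (proj₂ src (b , x<b , b<c , (vcb , essential) , sym cx≡cb , sb≢0))
      where
      bx<s : I b x ℕ.< s b
      bx<s = ℕₚ.≤∧≢⇒< (T₁.bound x<b) bx≢s
      sb≢0 : s b ≢ 0
      sb≢0 e = ℕₚ.n≮0 (subst (I b x ℕ.<_) e bx<s)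
      cx≡cb : I c x ≡ I c b
      cx≡cb = T₁.descendant-inv xb b<c
      -- Unless J c x ≤ J c b, planarity of J makes (b , x) vary.
      vcb : Varies T₁ T₂ c b
      vcb with T₂.planar x<b b<c
      ... | inj₁ Jcx≤Jcb = b<c , ℕₚ.≤-trans (subst (ℕ._< J c x) cx≡cb (proj₂ vcx)) Jcx≤Jcb
      ... | inj₂ Jbx≡s   = proj₁ (varies-upper x b c x<b b<c _ _ (vcx , refl)
              ((x<b , subst (I b x ℕ.<_) (sym Jbx≡s) bx<s) , refl))
      -- A node with b in a middle child also has x there.
      essential : ¬ Inessential c b
      essential (d , b<d , d<c , mid , vcd) =
        proj₂ (proj₁ src) (d , ℕₚ.<-trans x<b b<d , d<c ,
          T₁.inMiddleChild (subst (0 ℕ.<_) same (proj₁ (proj₂ (T₁.middle-inv mid))))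
            (subst (ℕ._< s d) same (proj₂ (proj₂ (T₁.middle-inv mid)))) , vcd)
        where
        same : I d b ≡ I d x
        same = sym (T₁.descendant-inv xb b<d)

    -- The root y of a nonempty right child would give an essential variation
    -- (c , y) of the same value, so that (x , y) has value 0 by the second
    -- condition, although it has value s x.
    source-emptyRight : 0 ℕ.< s x → rightChild T₁ x ≡ leaf
    source-emptyRight 0<s with leaf-or-largest (rightChild T₁ x)
      (subtrees-decreasing (DecreasingTree.decreasing T₁) (DecreasingTree.nodeOf T₁ x) (fromℕ (s x)))
    ... | inj₁ empty = empty
    ... | inj₂ (y , y∈ , largest) = ⊥-elim (ℕₚ.<-irrefl refl (subst (0 ℕ.<_) s≡0 0<s))
      where
      yx : Descendant T₁ y x
      yx = fromℕ (s x) , y∈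
      y<x : y < x
      y<x = T₁.child-< y∈
      y<c : y < c
      y<c = ℕₚ.<-trans y<x x<c
      xy≡s : I x y ≡ s x
      xy≡s = T₁.rightChild-inv y∈
      cy≡cx : I c y ≡ I c x
      cy≡cx = T₁.descendant-inv yx x<c
      vcy : Varies T₁ T₂ c y
      vcy = y<c , ℕₚ.≤-trans (subst (ℕ._< J c x) (sym cy≡cx) (proj₂ vcx))
        (T₂.transitive y<x x<c (ℕₚ.≤-trans (subst (0 ℕ.<_) (sym xy≡s) 0<s) (T₁≼T₂ y x y<x)))
      -- A node b with y in a middle child is an ancestor of x, since y is the
      -- root of the right child of x, and so has x in the same middle child.
      essential : ¬ Inessential c y
      essential (b , y<b , b<c , mid , vcb) with T₁.middle-inv mid | <-cmp b x
      ... | yb , _ , _   | tri< b<x _ _  = ℕₚ.<⇒≱ y<b (largest b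
              (T₁.inRightChild bx (trans (sym (T₁.descendant-inv yb b<x)) xy≡s)))
        where
        bx : Descendant T₁ b x
        bx = T₁.ancestors-nested b<x yb yx
      ... | _ , _ , xy<s | tri≈ _ refl _ = ℕₚ.<-irrefl xy≡s xy<s
      ... | _ , 0<v , v<s | tri> _ _ x<b = proj₂ (proj₁ src) (b , x<b , b<c ,
              T₁.inMiddleChild (subst (0 ℕ.<_) by≡bx 0<v) (subst (ℕ._< s b) by≡bx v<s) , vcb)
        where
        by≡bx : I b y ≡ I b x
        by≡bx = T₁.descendant-inv yx x<b
      s≡0 : s x ≡ 0
      s≡0 = trans (sym xy≡s) (sym (proj₂ (essential-pair-varies y x c y<x x<c (I c x)
        ((vcy , sym cy≡cx) , essential) ((vcx , refl) , proj₂ (proj₁ src))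
        λ sx≡0 → ℕₚ.<-irrefl (sym sx≡0) 0<s)))

    source-ascent : TreeAscent T₁ x c
    source-ascent = record
      { a<c        = x<c
      ; descendant = xc
      ; notInRight = λ r → ℕₚ.<-irrefl (T₁.rightChild-inv r) (varies-value vcx)
      ; between    = source-between
      ; emptyRight = source-emptyRight
      }

  Path : Fin n → Fin n → Set
  Path = TransitivityPath (increase I A)

  -- Paths, including those of length zero.
  Path₀ : Fin n → Fin n → Set
  Path₀ x a = x ≡ a ⊎ Path x a

  _++₀_ : ∀ {x b a} → Path₀ x b → Path b a → Path x a
  inj₁ refl ++₀ q = q
  inj₂ p    ++₀ q = p ++ q

  _++₁_ : ∀ {c x a} → Path c x → Path₀ x a → Path c a
  p ++₁ inj₁ refl = p
  p ++₁ inj₂ q    = p ++ q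

  source-step : ∀ {x c} → Source x c → x < c × 0 ℕ.< increase I A c x
  source-step src = x<c src , subst (0 ℕ.<_) (sym (source-increase src)) ℕₚ.0<1+n

  -- By induction on c, and for a fixed c on a downwards.  If b is the witness
  -- that (c , a) is inessential or covered, then (c , b) is reached and b is
  -- connected to a, in the covered case through the source of (b , a).
  reach : ∀ {c a} → Acc _<_ c → Acc _>_ a → Varies T₁ T₂ c a →
    ∃[ x ] Source x c × I c x ≡ I c a × Path₀ x a
  reach {c} (acc rc) = reach-from-c
    where
    reach-from-c : ∀ {a} → Acc _>_ a → Varies T₁ T₂ c a →
      ∃[ x ] Source x c × I c x ≡ I c a × Path₀ x a
    reach-from-c {a} (acc ra) vca with inessential? c a | covered? c a
    ... | no ess | no ¬cov = a , ((vca , ess) , ¬cov) , refl , inj₁ refl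
    ... | yes (b , a<b , b<c , mid , vcb) | _
      with reach-from-c (ra a<b) vcb | T₁.middle-inv mid
    ...   | x , src , e , p | ab , 0<ba , _ =
      x , src , trans e (sym (T₁.descendant-inv ab b<c)) ,
        inj₂ (p ++₀ [ a<b , ℕₚ.≤-trans 0<ba increase-≥ ])
    reach-from-c {a} (acc ra) vca
        | no ess | yes (b , a<b , b<c , (vcb , essb) , e , sb≢0)
      with reach-from-c (ra a<b) vcb
         | reach (rc b<c) (>-wellFounded a)
             (proj₁ (essential-pair-varies a b c a<b b<c (I c a)
               ((vca , refl) , ess) ((vcb , sym e) , essb) sb≢0))
    ...   | x , src , e′ , p | x′ , src′ , _ , p′ =
      x , src , trans e′ e , inj₂ (p ++₀ ([ source-step src′ ] ++₁ p′))

  -- Sources have amplitude one, so the increased multi-set is at most J; as J is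
  -- transitive, so are the first multiplicities of its paths.
  increase-≤ : ∀ {a c} → a < c → increase I A c a ℕ.≤ J c a
  increase-≤ {a} {c} a<c with increase-cases a c
  ... | inj₁ (Aac , e) = ℕₚ.≤-reflexive (trans e (sym (varies-J (proj₁ (proj₁ (A-sound Aac))))))
  ... | inj₂ e         = ℕₚ.≤-trans (ℕₚ.≤-reflexive e) (T₁≼T₂ a c a<c)

  path-bound : ∀ {a c} (p : Path c a) → firstMultiplicity (increase I A) p ℕ.≤ J c a
  path-bound [ (a<c , _) ]   = increase-≤ a<c
  path-bound ((b<c , _) ∷ p) = ℕₚ.≤-trans (increase-≤ b<c)
    (T₂.transitive (path-< p) b<c (ℕₚ.≤-trans (firstMultiplicity-positive p) (path-bound p)))

  source-firstMultiplicity : ∀ {c x a} → Source x c → Path₀ x a →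
    ∃[ p ] firstMultiplicity (increase I A) {c} {a} p ≡ suc (I c x)
  source-firstMultiplicity src (inj₁ refl) = [ source-step src ] , source-increase src
  source-firstMultiplicity src (inj₂ p)    = (source-step src ∷ p) , source-increase src

  isSum : IsSum T₁ A T₂
  isSum a c a<c with varies? c a
  ... | yes vca with reach (<-wellFounded c) (>-wellFounded a) vca
  ...   | x , src , e , p with source-firstMultiplicity src p
  ...     | q , f = inj₁ (q , trans f (trans (cong suc e) (sym (varies-J vca))) , path-bound)
  isSum a c a<c | no ¬vca with 0 ℕ.<? increase I A c a
  ... | yes 0<  = inj₁ ([ a<c , 0< ] , ℕₚ.≤-antisym (increase-≤ a<c)
                    (ℕₚ.≤-trans (ℕₚ.≤-reflexive (constant-J a<c ¬vca)) increase-≥) , path-bound)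
  ... | no ¬0<  = inj₂ ((λ p → ℕₚ.<-irrefl refl (ℕₚ.≤-trans (firstMultiplicity-positive p)
                    (subst (firstMultiplicity (increase I A) p ℕ.≤_) J≡0 (path-bound p)))) , J≡0)
    where
    J≡0 : J c a ≡ 0
    J≡0 = trans (constant-J a<c ¬vca)
      (ℕₚ.n≤0⇒n≡0 (ℕₚ.≤-trans increase-≥ (ℕₚ.≮⇒≥ ¬0<)))

  pure : PureInterval T₁ T₂
  pure = A , (λ a c e → source-ascent (A-sound e)) , isSum

theorem3p9 : ∀ {n : ℕ} (s : WeakComposition n) (T₁ T₂ : DecreasingTree s) → T₁ ≼ T₂ →
    PureInterval T₁ T₂ ⇔
    ( PlusOneInterval T₁ T₂
    × (∀ (a b c : Fin n) → a < b → b < c → ∀ (v w : ℕ) →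
    Var T₁ T₂ c a v → Var T₁ T₂ b a w → Var T₁ T₂ c b v)
    × (∀ (a b c : Fin n) → a < b → b < c → ∀ (v : ℕ) →
    EVar T₁ T₂ c a v → EVar T₁ T₂ c b v → s b ≢ 0 → Var T₁ T₂ b a 0) )
theorem3p9 s T₁ T₂ T₁≼T₂ = mk⇔ to from
  where
  to : _ → _
  to (A , ascents , isSum) =
      plusOne
    , (λ a b c a<b b<c v w vca vba →
         let vcb = varies-upper (<-wellFounded c) a<b b<c (proj₁ vca) (proj₁ vba)
         in vcb , trans (proj₂ vca) (T₁.descendant-inv (variation-descendant (proj₁ vba)) b<c))
    , (λ a b c a<b b<c v → essential-pair-varies (<-wellFounded c) a<b b<c)
    where
    open Necessity T₁ T₂ T₁≼T₂ A ascents isSum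
    module T₁ = TreeInversions T₁
  from : _ → _
  from (plusOne , varies-upper , essential-pair-varies) =
    Sufficiency.pure T₁ T₂ T₁≼T₂ plusOne varies-upper essential-pair-varies
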